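{- The scheme $\alpha \rightarrow_{d} \mathop{\sim}\mathop{\sim}\alpha$ is not provable in the axiom system $\mathrm{C}$; that is, there is a formula $\alpha$ such that $\alpha \rightarrow_{d} \mathop{\sim}\mathop{\sim}\alpha$ is not a theorem of $\mathrm{C}$.
   Context: Formulas are built from a countably infinite set of propositional variables using the unary connective $\sim$ (negation) and the binary connectives $\vee$ (disjunction), $\rightarrow_{d}$ (discussive implication), $\wedge_{d}$ (discussive conjunction), all treated as primitive. $\sim$ binds more tightly than the binary connectives. The axiom system $\mathrm{C}$ has as its sole rule modus ponens for $\rightarrow_{d}$ (from $\alpha$ and $\alpha\rightarrow_{d}\beta$ infer $\beta$), and as axioms all instances (for arbitrary formulas $\alpha,\beta,\gamma$) of the following schemes: C1: $\alpha\rightarrow_{d}(\beta\rightarrow_{d}\alpha)$. C2: $(\alpha\rightarrow_{d}(\beta\rightarrow_{d}\gamma))\rightarrow_{d}((\alpha\rightarrow_{d}\beta)\rightarrow_{d}(\alpha\rightarrow_{d}\gamma))$. C3: $(\alpha\wedge_{d}\beta)\rightarrow_{d}\alpha$. C4: $(\alpha\wedge_{d}\beta)\rightarrow_{d}\beta$. C5: $\alpha\rightarrow_{d}(\beta\rightarrow_{d}(\alpha\wedge_{d}\beta))$. C6: $\alpha\rightarrow_{d}(\alpha\vee\beta)$. C7: $\beta\rightarrow_{d}(\alpha\vee\beta)$. C8: $(\alpha\rightarrow_{d}\gamma)\rightarrow_{d}((\beta\rightarrow_{d}\gamma)\rightarrow_{d}((\alpha\vee\beta)\rightarrow_{d}\gamma))$.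 C9: $\alpha\vee(\alpha\rightarrow_{d}\beta)$. C10: $\sim(\sim\alpha\wedge_{d}(\sim\sim\alpha\wedge_{d}\sim(\alpha\vee\sim\alpha)))$. C11: $\sim(\sim\alpha\wedge_{d}(\sim\beta\wedge_{d}\sim(\alpha\vee\beta)))\rightarrow_{d}\sim(\sim\alpha\wedge_{d}(\sim\beta\wedge_{d}(\sim\gamma\wedge_{d}\sim(\alpha\vee(\beta\vee\gamma)))))$. C12: $\sim(\sim\alpha\wedge_{d}(\sim\beta\wedge_{d}(\sim\gamma\wedge_{d}\sim(\alpha\vee(\beta\vee\gamma)))))\rightarrow_{d}\sim(\sim\alpha\wedge_{d}(\sim\gamma\wedge_{d}(\sim\beta\wedge_{d}\sim(\alpha\vee(\gamma\vee\beta)))))$. C13: $\sim(\sim\alpha\wedge_{d}(\sim\beta\wedge_{d}(\sim\gamma\wedge_{d}\sim(\alpha\vee(\beta\vee\gamma)))))\rightarrow_{d}((\alpha\vee(\beta\vee\sim\gamma))\rightarrow_{d}(\alpha\vee\beta))$. C14: $\sim(\sim\alpha\wedge_{d}\sim\beta)\rightarrow_{d}(\alpha\vee\beta)$. C15: $(\alpha\vee(\beta\vee\sim\beta))\rightarrow_{d}\sim(\sim\alpha\wedge_{d}\sim(\beta\vee\sim\beta))$. A theorem of $\mathrm{C}$ is a formula derivable from these axioms by finitely many applications of modus ponens. A scheme is said to be unprovable in $\mathrm{C}$ if at least one of its instances is not a theorem of $\mathrm{C}$. -}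

module Defs where

open import Data.Nat using (ℕ)

infix  9 ∼_
infix  7 _∧d_
infix  6 _∨_
infixr 5 _→d_

data Formula : Set where
  var  : ℕ → Formula
  ∼_   : Formula → Formula
  _∨_  : Formula → Formula → Formula
  _→d_ : Formula → Formula → Formula
  _∧d_ : Formula → Formula → Formula

data Axiom : Formula → Set where
  C1  : ∀ α β → Axiom (α →d (β →d α))
  C2  : ∀ α β γ → Axiom ((α →d (β →d γ)) →d ((α →d β) →d (α →d γ)))
  C3  : ∀ α β → Axiom ((α ∧d β) →d α)
  C4  : ∀ α β → Axiom ((α ∧d β) →d β)
  C5  : ∀ α β → Axiom (α →d (β →d (α ∧d β)))
  C6  : ∀ α β → Axiom (α →d (α ∨ β))
  C7  : ∀ α β → Axiom (β →d (α ∨ β))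
  C8  : ∀ α β γ → Axiom ((α →d γ) →d ((β →d γ) →d ((α ∨ β) →d γ)))
  C9  : ∀ α β → Axiom (α ∨ (α →d β))
  C10 : ∀ α → Axiom (∼ (∼ α ∧d (∼ ∼ α ∧d ∼ (α ∨ ∼ α))))
  C11 : ∀ α β γ → Axiom
          (∼ (∼ α ∧d (∼ β ∧d ∼ (α ∨ β)))
            →d ∼ (∼ α ∧d (∼ β ∧d (∼ γ ∧d ∼ (α ∨ (β ∨ γ))))))
  C12 : ∀ α β γ → Axiom
          (∼ (∼ α ∧d (∼ β ∧d (∼ γ ∧d ∼ (α ∨ (β ∨ γ)))))
            →d ∼ (∼ α ∧d (∼ γ ∧d (∼ β ∧d ∼ (α ∨ (γ ∨ β))))))
  C13 : ∀ α β γ → Axiom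
          (∼ (∼ α ∧d (∼ β ∧d (∼ γ ∧d ∼ (α ∨ (β ∨ γ)))))
            →d ((α ∨ (β ∨ ∼ γ)) →d (α ∨ β)))
  C14 : ∀ α β → Axiom (∼ (∼ α ∧d ∼ β) →d (α ∨ β))
  C15 : ∀ α β → Axiom ((α ∨ (β ∨ ∼ β)) →d ∼ (∼ α ∧d ∼ (β ∨ ∼ β)))

infix 4 ⊢_

data ⊢_ : Formula → Set where
  ax : ∀ {α} → Axiom α → ⊢ α
  mp : ∀ {α β} → ⊢ α → ⊢ (α →d β) → ⊢ β

{-# OPTIONS --safe #-}
-- C is sound for a three-valued matrix with values 0 < 1 < 2, where 1 and 2 are designated.
-- Here ∼ sends 2 to 0 and both other values to 2, disjunction is the maximum, and ∧d and →d
-- are classical on designation, with values in {0, 2}.  A formula of value 1 is designated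
-- together with its negation, but its double negation has value 0.
module Submission where

open import Defs
open import Data.Fin using (Fin; suc; _≟_)
open import Data.Fin.Patterns using (0F; 1F; 2F)
open import Data.Fin.Properties using (all?)
open import Data.Nat using (ℕ; zero; suc)
open import Data.Product using (∃-syntax; _,_)
open import Relation.Binary.PropositionalEquality using (_≢_; refl)
open import Relation.Nullary using (¬_; Dec; ¬?; contradiction)
open import Relation.Nullary.Decidable using (True; toWitness)

Value : Set
Value = Fin 3

neg : Value → Value
neg 2F = 0F
neg _  = 2F

_or_ _and_ _imp_ : Value → Value → Value

0F or y     = y
1F or 0F    = 1F
1F or suc y = suc y
2F or _     = 2F

suc _ and suc _ = 2F
_     and _     = 0F

suc _ imp 0F = 0F
_     imp _  = 2F

⟦_⟧ : Formula → (ℕ → Value) → Value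
⟦ var n ⟧  ρ = ρ n
⟦ ∼ α ⟧    ρ = neg (⟦ α ⟧ ρ)
⟦ α ∨ β ⟧  ρ = ⟦ α ⟧ ρ or ⟦ β ⟧ ρ
⟦ α →d β ⟧ ρ = ⟦ α ⟧ ρ imp ⟦ β ⟧ ρ
⟦ α ∧d β ⟧ ρ = ⟦ α ⟧ ρ and ⟦ β ⟧ ρ

Designated : Value → Set
Designated x = x ≢ 0F

designated-mp : ∀ x y → Designated x → Designated (x imp y) → Designated y
designated-mp 0F      _       dx _  = contradiction refl dx
designated-mp (suc _) 0F      _  di = di
designated-mp (suc _) (suc _) _  _  = λ ()

-- No axiom scheme has more than three metavariables, so three values are enough for a finite truth
-- table.
assign : Value → Value → Value → ℕ → Value
assign x _ _ zero          = x
assign _ y _ (suc zero)    = y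
assign _ _ z (suc (suc _)) = z

Tautology : Formula → Set
Tautology φ = ∀ x y z → Designated (⟦ φ ⟧ (assign x y z))

tautology? : ∀ φ → Dec (Tautology φ)
tautology? φ = all? λ x → all? λ y → all? λ z → ¬? (⟦ φ ⟧ (assign x y z) ≟ 0F)

-- The `Axiom` argument supplies `φ`; for concrete `φ` the `True` argument reduces to the unit type,
-- so type checking runs the truth table.
scheme : ∀ {φ} → Axiom φ → {True (tautology? φ)} → Tautology φ
scheme _ {t} = toWitness t

-- The value of an instance of a scheme is definitionally the value of its instance at the
-- variables p, q, r, so a truth table for the latter settles all instances.
axiom-sound : ∀ ρ {φ} → Axiom φ → Designated (⟦ φ ⟧ ρ)
axiom-sound ρ = sound
  where
  p q r : Formula
  p = var 0
  q = var 1
  r = var 2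

  v : Formula → Value
  v α = ⟦ α ⟧ ρ

  sound : ∀ {φ} → Axiom φ → Designated (⟦ φ ⟧ ρ)
  -- `0F` fills the place of a metavariable absent from the scheme.
  sound (C1 α β)    = scheme (C1 p q) (v α) (v β) 0F
  sound (C2 α β γ)  = scheme (C2 p q r) (v α) (v β) (v γ)
  sound (C3 α β)    = scheme (C3 p q) (v α) (v β) 0F
  sound (C4 α β)    = scheme (C4 p q) (v α) (v β) 0F
  sound (C5 α β)    = scheme (C5 p q) (v α) (v β) 0F
  sound (C6 α β)    = scheme (C6 p q) (v α) (v β) 0F
  sound (C7 α β)    = scheme (C7 p q) (v α) (v β) 0F
  sound (C8 α β γ)  = scheme (C8 p q r) (v α) (v β) (v γ)
  sound (C9 α β)    = scheme (C9 p q) (v α) (v β) 0F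
  sound (C10 α)     = scheme (C10 p) (v α) 0F 0F
  sound (C11 α β γ) = scheme (C11 p q r) (v α) (v β) (v γ)
  sound (C12 α β γ) = scheme (C12 p q r) (v α) (v β) (v γ)
  sound (C13 α β γ) = scheme (C13 p q r) (v α) (v β) (v γ)
  sound (C14 α β)   = scheme (C14 p q) (v α) (v β) 0F
  sound (C15 α β)   = scheme (C15 p q) (v α) (v β) 0F

soundness : ∀ ρ {φ} → ⊢ φ → Designated (⟦ φ ⟧ ρ)
soundness ρ (ax a) = axiom-sound ρ a
soundness ρ (mp {α} {β} ⊢α ⊢α→β) =
  designated-mp (⟦ α ⟧ ρ) (⟦ β ⟧ ρ) (soundness ρ ⊢α) (soundness ρ ⊢α→β)

proposition2p1 : ∃[ α ] ¬ (⊢ (α →d (∼ (∼ α))))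
-- At value 1 the formula computes to `1F imp 0F`, that is `0F`, so `refl` refutes designation.
proposition2p1 = var 0 , λ d → soundness (λ _ → 1F) d refl
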